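{- For every integer $n > 2$, the tensor product graph $P_n \wedge P_3$ is odd graceful.
   Context: All graphs are finite and simple. $P_n$ denotes the path graph on $n$ vertices. The tensor product $G_1 \wedge G_2$ of two graphs $G_1, G_2$ is the graph with vertex set $V(G_1) \times V(G_2)$ in which $(u_1,v_1)$ and $(u_2,v_2)$ are adjacent if and only if $u_1u_2 \in E(G_1)$ and $v_1v_2 \in E(G_2)$. An odd graceful labeling of a graph $G$ with $q = |E(G)|$ edges is a one-to-one function $f : V(G) \to \{0,1,2,\ldots,2q-1\}$ such that, when each edge $uv$ is given the label $f^*(uv) = |f(u)-f(v)|$, the resulting set of edge labels is exactly $\{1,3,5,\ldots,2q-1\}$ (so the $q$ edge labels are distinct). A graph is odd graceful if it has an odd graceful labeling. -}

module Defs where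

open import Data.Fin.Base using (Fin; toℕ; _<_)
open import Data.Fin.Properties using (_<?_; *↔×)
open import Data.List.Base using (List; map; filter; length; allFin; cartesianProduct)
open import Data.Nat.Base as ℕ using (ℕ; suc; _+_; _*_; ∣_-_∣)
open import Data.Nat.Properties using (_≟_; 1+n≢n)
open import Data.Product.Base using (_×_; _,_; ∃; ∃₂; ∃-syntax)
open import Data.Product.Function.NonDependent.Propositional using (_×-↔_)
open import Data.Sum.Base using (_⊎_; inj₁; inj₂; swap)
open import Function.Base using (_∘_)
open import Function.Bundles using (_↔_; Inverse)
open import Function.Construct.Composition using (_↔-∘_)
open import Function.Construct.Identity using (↔-id)
open import Function.Construct.Symmetry using (↔-sym)
open import Function.Definitions using (Injective)
open import Relation.Binary.Core using (Rel)
open import Relation.Binary.Definitions using (Irreflexive; Symmetric; Decidable)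
open import Relation.Binary.PropositionalEquality using (_≡_; refl; sym)
open import Relation.Nullary.Decidable using (_×-dec_; _⊎-dec_)
open import Relation.Unary using (Pred; _≐_)
open import Level using (0ℓ)

record Graph : Set₁ where
  field
    V          : Set
    order      : ℕ
    enum       : V ↔ Fin order
    Adj        : Rel V 0ℓ
    Adj?       : Decidable Adj
    Adj-sym    : Symmetric Adj
    Adj-irrefl : Irreflexive _≡_ Adj

  index : V → Fin order
  index = Inverse.to enum

  vertices : List V
  vertices = map (Inverse.from enum) (allFin order)

  -- Each unordered edge is listed once, as the pair whose first component
  -- comes first in the enumeration.
  edges : List (V × V)
  edges = filter (λ (u , v) → (index u <? index v) ×-dec Adj? u v)
                 (cartesianProduct vertices vertices)

  size : ℕ
  size = length edges

P : ℕ → Graph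
P n = record
  { V          = Fin n
  ; order      = n
  ; enum       = ↔-id (Fin n)
  ; Adj        = λ i j → suc (toℕ i) ≡ toℕ j ⊎ suc (toℕ j) ≡ toℕ i
  ; Adj?       = λ i j → (suc (toℕ i) ≟ toℕ j) ⊎-dec (suc (toℕ j) ≟ toℕ i)
  ; Adj-sym    = swap
  ; Adj-irrefl = λ { refl (inj₁ e) → 1+n≢n e ; refl (inj₂ e) → 1+n≢n e }
  }

infixr 6 _∧_

_∧_ : Graph → Graph → Graph
G ∧ H = record
  { V          = G.V × H.V
  ; order      = G.order * H.order
  ; enum       = ↔-sym *↔× ↔-∘ (G.enum ×-↔ H.enum)
  ; Adj        = λ (u₁ , v₁) (u₂ , v₂) → G.Adj u₁ u₂ × H.Adj v₁ v₂
  ; Adj?       = λ (u₁ , v₁) (u₂ , v₂) → G.Adj? u₁ u₂ ×-dec H.Adj? v₁ v₂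
  ; Adj-sym    = λ (a , b) → G.Adj-sym a , H.Adj-sym b
  ; Adj-irrefl = λ { refl (a , _) → G.Adj-irrefl refl a }
  }
  where
  module G = Graph G
  module H = Graph H

module _ (G : Graph) where
  open Graph G

  EdgeLabels : (V → ℕ) → Pred ℕ 0ℓ
  EdgeLabels f k = ∃₂ λ u v → Adj u v × k ≡ ∣ f u - f v ∣

  -- As there are size-many edges and size-many required labels, the equality
  -- of sets forces distinct edges to have distinct labels.
  record IsOddGraceful (f : V → Fin (2 * size)) : Set where
    field
      injective  : Injective _≡_ _≡_ f
      edgeLabels : EdgeLabels (toℕ ∘ f) ≐ λ k → ∃[ i ] i ℕ.< size × k ≡ 2 * i + 1

  OddGraceful : Set
  OddGraceful = ∃ IsOddGraceful

{-# OPTIONS --safe #-}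

-- Write n = m + 1, and let ī = m − i be the rank of layer i of P n.  The product
-- consists of two chains of 4-cycles, in which layers with two vertices, (i , 0)
-- and (i , 2), alternate with layers with the single vertex (i , 1), and
-- consecutive layers are completely joined.  In each chain the pair labels
-- increase and the single labels decrease as ī grows, in steps that make the
-- differences run through consecutive odd numbers.  The chain in which the layers
-- of odd rank are single takes the upper half of the odd numbers below 8m, the
-- other chain takes the lower half; an odd shift of the latter keeps the vertex
-- labels of the two chains apart.

module Submission where

open import Defs
open import Data.Nat.Base using (ℕ; _>_)

open import Data.Fin.Base as Fin using (Fin; suc; toℕ; fromℕ<; inject₁; combine; remQuot)
open import Data.Fin.Patterns using (0F; 1F; 2F)
open import Data.Fin.Properties as Fin
  using (toℕ-fromℕ<; toℕ-injective; toℕ-inject₁; toℕ<n; toℕ≤pred[n]; toℕ-combine;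
         combine-monoˡ-<; remQuot-combine; combine-remQuot)
open import Data.List.Base using (cartesianProduct; tabulate)
open import Data.List.Membership.Propositional using (_∈_)
open import Data.List.Membership.Propositional.Properties
  using (∈-filter⁺; ∈-filter⁻; ∈-cartesianProduct⁺; ∈-map⁺; ∈-allFin; ∈-tabulate⁺; ∈-tabulate⁻)
open import Data.List.Membership.Propositional.Properties.WithK using (unique∧set⇒bag)
open import Data.List.Properties using (length-tabulate)
open import Data.List.Relation.Binary.BagAndSetEquality using (∼bag⇒↭)
open import Data.List.Relation.Binary.Permutation.Propositional.Properties using (↭-length)
open import Data.List.Relation.Unary.Unique.Propositional using (Unique)
open import Data.List.Relation.Unary.Unique.Propositional.Properties as Unique using ()
open import Data.Nat.Base using (suc; _+_; _*_; _∸_; _≤_; _<_; z≤n; s≤s; ∣_-_∣; parity)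
open import Data.Nat.Properties
open import Data.Nat.Tactic.RingSolver using (solve-∀)
open import Data.Parity.Base using (Parity; 0ℙ; 1ℙ; _⁻¹)
open import Data.Product.Base using (_×_; _,_; ∃₂; ∃-syntax; proj₁; proj₂; map₂)
open import Data.Sum.Base using (_⊎_; inj₁; inj₂)
open import Function.Base using (_∘_)
open import Function.Bundles using (Injection; Inverse; mk⇔)
open import Function.Construct.Symmetry using (↔-sym)
open import Function.Definitions using (Injective)
open import Function.Properties.Inverse using (↔⇒↣)
open import Relation.Binary.PropositionalEquality
  using (_≡_; _≢_; refl; sym; trans; cong; cong₂; subst; module ≡-Reasoning)
open import Relation.Nullary.Decidable using (_×-dec_)
open import Relation.Nullary.Negation using (contradiction)

-- Enumerating edges so that edge `k` has label `2k + 1`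

module _ (G : Graph) where
  open Graph G

  ∈-vertices : ∀ v → v ∈ vertices
  ∈-vertices v = subst (_∈ vertices) (Inverse.strictlyInverseʳ enum v)
    (∈-map⁺ (Inverse.from enum) (∈-allFin (index v)))

  vertices-unique : Unique vertices
  vertices-unique = Unique.map⁺ (Injection.injective (↔⇒↣ (↔-sym enum))) (Unique.allFin⁺ order)

  edges-unique : Unique edges
  edges-unique = Unique.filter⁺ _ (Unique.cartesianProduct⁺ vertices-unique vertices-unique)

  module _ {q : ℕ} (ends : Fin q → V × V)
           (ends-injective : Injective _≡_ _≡_ ends)
           (ends-ordered : ∀ k → index (proj₁ (ends k)) Fin.< index (proj₂ (ends k)))
           (ends-adjacent : ∀ k → Adj (proj₁ (ends k)) (proj₂ (ends k)))
           (ends-complete : ∀ {u v} → Adj u v →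
                            ∃[ k ] (ends k ≡ (u , v) ⊎ ends k ≡ (v , u)))
           where

    ends∈edges : ∀ k → ends k ∈ edges
    ends∈edges k = ∈-filter⁺ _ (∈-cartesianProduct⁺ (∈-vertices _) (∈-vertices _))
      (ends-ordered k , ends-adjacent k)

    edges⊆ends : ∀ {e} → e ∈ edges → e ∈ tabulate ends
    edges⊆ends {u , v} e∈edges
      with u<v , u~v ← proj₂ (∈-filter⁻
             (λ (u , v) → (index u Fin.<? index v) ×-dec Adj? u v)
             {xs = cartesianProduct vertices vertices} e∈edges)
      with ends-complete u~v
    ... | k , inj₁ eq = subst (_∈ tabulate ends) eq (∈-tabulate⁺ k)
    -- A reversed match would put the same two endpoints in both index orders.
    ... | k , inj₂ eq = contradiction u<v (Fin.<-asym v<u)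
      where
      v<u : index v Fin.< index u
      v<u = subst (λ (x , y) → index x Fin.< index y) eq (ends-ordered k)

    ends⊆edges : ∀ {e} → e ∈ tabulate ends → e ∈ edges
    ends⊆edges e∈ends with k , refl ← ∈-tabulate⁻ e∈ends = ends∈edges k

    -- Two duplicate-free lists with the same members are permutations of each other, so their
    -- lengths agree.
    size≡ : size ≡ q
    size≡ = trans
      (↭-length (∼bag⇒↭ (unique∧set⇒bag edges-unique (Unique.tabulate⁺ ends-injective)
        (mk⇔ edges⊆ends ends⊆edges))))
      (length-tabulate ends)

  module _ {q : ℕ} (ends : Fin q → V × V)
           (ends-ordered : ∀ k → index (proj₁ (ends k)) Fin.< index (proj₂ (ends k)))
           (ends-adjacent : ∀ k → Adj (proj₁ (ends k)) (proj₂ (ends k)))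
           (ends-complete : ∀ {u v} → Adj u v →
                            ∃[ k ] (ends k ≡ (u , v) ⊎ ends k ≡ (v , u)))
           (f : V → ℕ)
           (f-injective : Injective _≡_ _≡_ f)
           (f<2q : ∀ v → f v < 2 * q)
           (edge-label : ∀ k → ∣ f (proj₁ (ends k)) - f (proj₂ (ends k)) ∣ ≡ 2 * toℕ k + 1)
           where

    -- The label `2k + 1` of an edge determines its position `k`.
    ends-injective : Injective _≡_ _≡_ ends
    ends-injective {k} {l} eq = toℕ-injective (*-cancelˡ-≡ _ _ 2 (+-cancelʳ-≡ 1 _ _
      (trans (sym (edge-label k))
        (trans (cong (λ (u , v) → ∣ f u - f v ∣) eq) (edge-label l)))))

    oddGraceful : OddGraceful G
    -- Identifying `q` with `size` turns the bound `f<2q` into membership in the required codomain.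
    oddGraceful with refl ← size≡ ends ends-injective ends-ordered ends-adjacent ends-complete =
      F , record
        { injective  = λ {u} {v} eq → f-injective
            (trans (sym (toℕ-F u)) (trans (cong toℕ eq) (toℕ-F v)))
        ; edgeLabels = only-odd , all-odd
        }
      where
      F : V → Fin (2 * q)
      F v = fromℕ< (f<2q v)

      toℕ-F : ∀ v → toℕ (F v) ≡ f v
      toℕ-F v = toℕ-fromℕ< (f<2q v)

      F-diff : ∀ u v → ∣ toℕ (F u) - toℕ (F v) ∣ ≡ ∣ f u - f v ∣
      F-diff u v = cong₂ ∣_-_∣ (toℕ-F u) (toℕ-F v)

      only-odd : ∀ {k} → EdgeLabels G (toℕ ∘ F) k → ∃[ i ] i < q × k ≡ 2 * i + 1
      only-odd (u , v , u~v , refl) with ends-complete u~v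
      ... | k , inj₁ refl = toℕ k , toℕ<n k , trans (F-diff u v) (edge-label k)
      ... | k , inj₂ refl = toℕ k , toℕ<n k ,
        trans (F-diff u v) (trans (∣-∣-comm (f u) (f v)) (edge-label k))

      all-odd : ∀ {k} → ∃[ i ] i < q × k ≡ 2 * i + 1 → EdgeLabels G (toℕ ∘ F) k
      all-odd (i , i<q , refl) = u , v , ends-adjacent k ,
        trans (cong (λ x → 2 * x + 1) (sym (toℕ-fromℕ< i<q)))
          (sym (trans (F-diff u v) (edge-label k)))
        where
        k = fromℕ< i<q
        u = proj₁ (ends k)
        v = proj₂ (ends k)

-- Parity bits and differences

parity-suc : ∀ n → parity (suc n) ≡ parity n ⁻¹
parity-suc 0             = refl
parity-suc 1             = refl
parity-suc (suc (suc n)) = parity-suc n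

p≢p⁻¹ : ∀ p → p ≢ p ⁻¹
p≢p⁻¹ 0ℙ ()
p≢p⁻¹ 1ℙ ()

bit : Parity → ℕ
bit 0ℙ = 0
bit 1ℙ = 1

bit+2*-injective : ∀ p q {a b} → bit p + 2 * a ≡ bit q + 2 * b → p ≡ q × a ≡ b
bit+2*-injective 0ℙ 0ℙ {a} {b} eq = refl , *-cancelˡ-≡ a b 2 eq
bit+2*-injective 0ℙ 1ℙ {a} {b} eq = contradiction eq (even≢odd a b)
bit+2*-injective 1ℙ 0ℙ {a} {b} eq = contradiction (sym eq) (even≢odd b a)
bit+2*-injective 1ℙ 1ℙ {a} {b} eq = refl , *-cancelˡ-≡ a b 2 (suc-injective eq)

bit+2*-< : ∀ p {a b} → a < b → bit p + 2 * a < 2 * b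
bit+2*-< p {a} {b} a<b = begin-strict
  bit p + 2 * a  ≤⟨ +-monoˡ-≤ (2 * a) (bit≤1 p) ⟩
  1 + 2 * a      <⟨ n<1+n _ ⟩
  2 + 2 * a      ≡⟨ *-suc 2 a ⟨
  2 * suc a      ≤⟨ *-monoʳ-≤ 2 a<b ⟩
  2 * b          ∎
  where
  open ≤-Reasoning
  bit≤1 : ∀ p → bit p ≤ 1
  bit≤1 0ℙ = z≤n
  bit≤1 1ℙ = s≤s z≤n

-- Symmetric in the endpoints, because the layer holding the larger label varies with the chain and
-- the parity.
gap⇒∣-∣ : ∀ {a b d} → a ≡ b + d ⊎ b ≡ a + d → ∣ a - b ∣ ≡ d
gap⇒∣-∣ {b = b} {d} (inj₁ refl) = trans (∣-∣-comm (b + d) b) (∣m-m+n∣≡n b d)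
gap⇒∣-∣ {a} {d = d} (inj₂ refl) = ∣m-m+n∣≡n a d

-- The vertex labels: injectivity and range

-- Here p is the parity of ī.  The value 3m of base makes the largest edge label
-- 8m − 1, the value m + 2 makes the smallest one 1, and both exceed every double of
-- their parity when m ≥ 2.

double : Parity → (ī e : ℕ) → ℕ
double p ī e = ī + e + bit p

base : ℕ → Parity → ℕ
base m 0ℙ = m + 2
base m 1ℙ = 3 * m

half : ℕ → Parity → (i ī : ℕ) → Fin 3 → ℕ
half m p i ī 0F = double p ī 1
half m p i ī 1F = base m p + i
half m p i ī 2F = double p ī 0

-- The low bit records the parity of the rank, so only layers of equal rank parity can collide: the
-- doubles of one chain with each other or with the singles of the other.
label : ℕ → Parity → (i ī : ℕ) → Fin 3 → ℕ
label m p i ī j = bit p + 2 * half m p i ī j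

module _ {m : ℕ} (2≤m : 2 ≤ m) where
  open ≤-Reasoning

  -- The arithmetic draws on `2 ≤ m`, that is `n > 2`, only here.
  m+4≤3m : m + 4 ≤ 3 * m
  m+4≤3m = +-monoʳ-≤ m (*-monoʳ-≤ 2 2≤m)

  base≤3m : ∀ p → base m p ≤ 3 * m
  base≤3m 0ℙ = ≤-trans (+-monoʳ-≤ m (s≤s (s≤s z≤n))) m+4≤3m
  base≤3m 1ℙ = ≤-refl

  double<base : ∀ p {ī e} → ī ≤ m → e ≤ 1 → double p ī e < base m p
  double<base p {ī} {e} ī≤m e≤1 = begin-strict
    ī + e + bit p  ≤⟨ +-monoˡ-≤ (bit p) (+-mono-≤ ī≤m e≤1) ⟩
    m + 1 + bit p  ≡⟨ +-assoc m 1 (bit p) ⟩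
    m + suc (bit p)  <⟨ gap p ⟩
    base m p       ∎
    where
    gap : ∀ p → m + suc (bit p) < base m p
    gap 0ℙ = +-monoʳ-< m (n<1+n 1)
    gap 1ℙ = <-≤-trans (+-monoʳ-< m (s≤s (s≤s (s≤s z≤n)))) m+4≤3m

  double≢single : ∀ p {ī e i} → ī ≤ m → e ≤ 1 → double p ī e ≢ base m p + i
  double≢single p {i = i} ī≤m e≤1 = <⇒≢ (<-≤-trans (double<base p ī≤m e≤1) (m≤m+n _ i))

  -- Distinct ranks of one parity differ by at least 2, so the pairs `{ī, ī + 1}` are disjoint; the
  -- singles lie above all of them and determine `i`.
  half-injective : ∀ p {i i′ ī ī′} → parity ī ≡ p → parity ī′ ≡ p →
    i + ī ≡ m → i′ + ī′ ≡ m → ∀ j j′ → half m p i ī j ≡ half m p i′ ī′ j′ → i ≡ i′ × j ≡ j′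
  half-injective p {i} {i′} {ī} {ī′} pī pī′ i+ī≡m i′+ī′≡m = go
    where
    ī≤m : ī ≤ m
    ī≤m = m+n≤o⇒n≤o i (≤-reflexive i+ī≡m)

    ī′≤m : ī′ ≤ m
    ī′≤m = m+n≤o⇒n≤o i′ (≤-reflexive i′+ī′≡m)

    same-rank : ī ≡ ī′ → i ≡ i′
    same-rank refl = +-cancelʳ-≡ ī i i′ (trans i+ī≡m (sym i′+ī′≡m))

    double-cancel : ∀ x y e d → double p x e ≡ double p y d → x + e ≡ y + d
    double-cancel x y e d = +-cancelʳ-≡ (bit p) (x + e) (y + d)

    same-double : ∀ e → double p ī e ≡ double p ī′ e → i ≡ i′
    same-double e = same-rank ∘ +-cancelʳ-≡ e ī ī′ ∘ double-cancel ī ī′ e e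

    consecutive : ∀ {x y} → parity x ≡ p → parity y ≡ p → double p x 1 ≢ double p y 0
    consecutive {x} {y} px py eq = p≢p⁻¹ p
      (trans (sym py) (trans (cong parity y≡1+x) (trans (parity-suc x) (cong _⁻¹ px))))
      where
      y≡1+x : y ≡ suc x
      y≡1+x = trans (sym (+-identityʳ y)) (trans (sym (double-cancel x y 1 0 eq)) (+-comm x 1))

    go : ∀ j j′ → half m p i ī j ≡ half m p i′ ī′ j′ → i ≡ i′ × j ≡ j′
    go 0F 0F eq = same-double 1 eq , refl
    go 2F 2F eq = same-double 0 eq , refl
    go 1F 1F eq = +-cancelˡ-≡ (base m p) i i′ eq , refl
    go 0F 2F eq = contradiction eq (consecutive pī pī′)
    go 2F 0F eq = contradiction (sym eq) (consecutive pī′ pī)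
    go 0F 1F eq = contradiction eq (double≢single p ī≤m ≤-refl)
    go 2F 1F eq = contradiction eq (double≢single p ī≤m z≤n)
    go 1F 0F eq = contradiction (sym eq) (double≢single p ī′≤m ≤-refl)
    go 1F 2F eq = contradiction (sym eq) (double≢single p ī′≤m z≤n)

  -- The bound is the number of edges: two chains, `m` steps between layers, two edges per step.
  half-< : ∀ {i ī} → i + ī ≡ m → ∀ j → half m (parity ī) i ī j < 2 * (m * 2)
  half-< {i} {ī} i+ī≡m = go
    where
    4m≡ : 3 * m + m ≡ 2 * (m * 2)
    4m≡ = four m
      where
      four : ∀ m → 3 * m + m ≡ 2 * (m * 2)
      four = solve-∀

    i≤m : i ≤ m
    i≤m = m+n≤o⇒m≤o i (≤-reflexive i+ī≡m)

    double-< : ∀ {e} → e ≤ 1 → double (parity ī) ī e < 2 * (m * 2)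
    double-< {e} e≤1 = begin-strict
      double (parity ī) ī e  <⟨ double<base (parity ī) (m+n≤o⇒n≤o i (≤-reflexive i+ī≡m)) e≤1 ⟩
      base m (parity ī)      ≤⟨ base≤3m (parity ī) ⟩
      3 * m                  ≤⟨ m≤m+n (3 * m) m ⟩
      3 * m + m              ≡⟨ 4m≡ ⟩
      2 * (m * 2)            ∎

    -- The top layer i = m has rank 0, so it is never single in the upper chain.
    single-< : ∀ p → parity ī ≡ p → base m p + i < 3 * m + m
    single-< 0ℙ _ = +-mono-<-≤
      (<-≤-trans (+-monoʳ-< m (s≤s (s≤s (s≤s z≤n)))) m+4≤3m) i≤m
    single-< 1ℙ odd = +-monoʳ-< (3 * m) (≤∧≢⇒< i≤m λ { refl →
      contradiction
        (trans (sym odd)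
          (cong parity (+-cancelˡ-≡ m ī 0 (trans i+ī≡m (sym (+-identityʳ m))))))
        λ () })

    go : ∀ j → half m (parity ī) i ī j < 2 * (m * 2)
    go 0F = double-< ≤-refl
    go 1F = subst (base m (parity ī) + i <_) 4m≡ (single-< (parity ī) refl)
    go 2F = double-< z≤n

-- The edges and their labels

-- An edge between layers t and t + 1 is given by its chain c (1F for the upper
-- one) and by the column δ of its endpoint in the layer with two vertices.

column : Fin 2 → Fin 3
column 0F = 0F
column 1F = 2F

-- Here `p` is the parity of the rank of layer `t + 1`, and the column in layer `t` comes first.
-- Changing either `p` or `c` moves the single vertex to the other layer.
columns : Parity → (c δ : Fin 2) → Fin 3 × Fin 3
columns 0ℙ 0F δ = column δ , 1F
columns 0ℙ 1F δ = 1F , column δ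
columns 1ℙ 0F δ = 1F , column δ
columns 1ℙ 1F δ = column δ , 1F

columns-adjacent : ∀ p c δ →
  Graph.Adj (P 3) (proj₁ (columns p c δ)) (proj₂ (columns p c δ))
columns-adjacent 0ℙ 0F 0F = inj₁ refl
columns-adjacent 0ℙ 0F 1F = inj₂ refl
columns-adjacent 0ℙ 1F 0F = inj₂ refl
columns-adjacent 0ℙ 1F 1F = inj₁ refl
columns-adjacent 1ℙ 0F 0F = inj₂ refl
columns-adjacent 1ℙ 0F 1F = inj₁ refl
columns-adjacent 1ℙ 1F 0F = inj₁ refl
columns-adjacent 1ℙ 1F 1F = inj₂ refl

-- Every edge of `P 3` has the middle vertex at exactly one end. With `p`, that end fixes the chain;
-- the outer vertex fixes `δ`.
columns-complete : ∀ p {j j′} → Graph.Adj (P 3) j j′ → ∃₂ λ c δ → columns p c δ ≡ (j , j′)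
columns-complete 0ℙ {0F} {1F} _ = 0F , 0F , refl
columns-complete 0ℙ {2F} {1F} _ = 0F , 1F , refl
columns-complete 0ℙ {1F} {0F} _ = 1F , 0F , refl
columns-complete 0ℙ {1F} {2F} _ = 1F , 1F , refl
columns-complete 1ℙ {0F} {1F} _ = 1F , 0F , refl
columns-complete 1ℙ {2F} {1F} _ = 1F , 1F , refl
columns-complete 1ℙ {1F} {0F} _ = 0F , 0F , refl
columns-complete 1ℙ {1F} {2F} _ = 0F , 1F , refl
columns-complete _ {0F} {0F} (inj₁ ())
columns-complete _ {0F} {0F} (inj₂ ())
columns-complete _ {0F} {2F} (inj₁ ())
columns-complete _ {0F} {2F} (inj₂ ())
columns-complete _ {1F} {1F} (inj₁ ())
columns-complete _ {1F} {1F} (inj₂ ())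
columns-complete _ {2F} {0F} (inj₁ ())
columns-complete _ {2F} {0F} (inj₂ ())
columns-complete _ {2F} {2F} (inj₁ ())
columns-complete _ {2F} {2F} (inj₂ ())

-- In each identity the vertex (i , 1) is on the left, having the larger label.
-- Writing 1 as e + δ makes the two columns, (e , δ) = (1 , 0) and (0 , 1),
-- instances of one semiring identity; t is the lower layer of the edge, and r the
-- rank of the upper one.
upper-even : ∀ r t e δ {m} → m ≡ r + (e + δ + t) →
  1 + 2 * (3 * m + t) ≡ 0 + 2 * (r + e + 0) + (2 * (m * 2 * 1 + (2 * t + δ)) + 1)
upper-even r t e δ refl = identity r t e δ
  where
  identity : ∀ r t e δ →
    1 + 2 * (3 * (r + (e + δ + t)) + t)
    ≡ 0 + 2 * (r + e + 0) + (2 * ((r + (e + δ + t)) * 2 * 1 + (2 * t + δ)) + 1)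
  identity = solve-∀

upper-odd : ∀ r t e δ {m} → m ≡ r + (e + δ + t) →
  1 + 2 * (3 * m + suc t) ≡ 0 + 2 * (suc r + e + 0) + (2 * (m * 2 * 1 + (2 * t + δ)) + 1)
upper-odd r t e δ refl = identity r t e δ
  where
  identity : ∀ r t e δ →
    1 + 2 * (3 * (r + (e + δ + t)) + (1 + t))
    ≡ 0 + 2 * (1 + r + e + 0) + (2 * ((r + (e + δ + t)) * 2 * 1 + (2 * t + δ)) + 1)
  identity = solve-∀

lower-even : ∀ r t e δ {m} → m ≡ r + (e + δ + t) →
  0 + 2 * (m + 2 + suc t) ≡ 1 + 2 * (suc r + e + 1) + (2 * (m * 2 * 0 + (2 * t + δ)) + 1)
lower-even r t e δ refl = identity r t e δ
  where
  identity : ∀ r t e δ →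
    0 + 2 * ((r + (e + δ + t)) + 2 + (1 + t))
    ≡ 1 + 2 * (1 + r + e + 1) + (2 * ((r + (e + δ + t)) * 2 * 0 + (2 * t + δ)) + 1)
  identity = solve-∀

lower-odd : ∀ r t e δ {m} → m ≡ r + (e + δ + t) →
  0 + 2 * (m + 2 + t) ≡ 1 + 2 * (r + e + 1) + (2 * (m * 2 * 0 + (2 * t + δ)) + 1)
lower-odd r t e δ refl = identity r t e δ
  where
  identity : ∀ r t e δ →
    0 + 2 * ((r + (e + δ + t)) + 2 + t)
    ≡ 1 + 2 * (r + e + 1) + (2 * ((r + (e + δ + t)) * 2 * 0 + (2 * t + δ)) + 1)
  identity = solve-∀

-- In `d` the lower chain takes the first `2m` odd numbers and the upper chain the next `2m`, two
-- consecutive ones per step. The disjunct tells which layer holds the single vertex.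
label-gap : ∀ r t {m} → m ≡ r + suc t → ∀ p c δ →
  let j , j′ = columns p c δ
      a = label m (p ⁻¹) t (suc r) j
      b = label m p (suc t) r j′
      d = 2 * (m * 2 * toℕ c + (2 * t + toℕ δ)) + 1
  in a ≡ b + d ⊎ b ≡ a + d
label-gap r t m≡ 0ℙ 0F 0F = inj₂ (lower-even r t 1 0 m≡)
label-gap r t m≡ 0ℙ 0F 1F = inj₂ (lower-even r t 0 1 m≡)
label-gap r t m≡ 0ℙ 1F 0F = inj₁ (upper-even r t 1 0 m≡)
label-gap r t m≡ 0ℙ 1F 1F = inj₁ (upper-even r t 0 1 m≡)
label-gap r t m≡ 1ℙ 0F 0F = inj₁ (lower-odd r t 1 0 m≡)
label-gap r t m≡ 1ℙ 0F 1F = inj₁ (lower-odd r t 0 1 m≡)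
label-gap r t m≡ 1ℙ 1F 0F = inj₂ (upper-odd r t 1 0 m≡)
label-gap r t m≡ 1ℙ 1F 1F = inj₂ (upper-odd r t 0 1 m≡)

-- Assembling the labeling of the product

module _ {m : ℕ} (2≤m : 2 ≤ m) where
  private
    module G = Graph (P (suc m) ∧ P 3)

  rank : Fin (suc m) → ℕ
  rank i = m ∸ toℕ i

  layer+rank : ∀ i → toℕ i + rank i ≡ m
  layer+rank i = m+[n∸m]≡n (toℕ≤pred[n] i)

  vertexLabel : G.V → ℕ
  vertexLabel (i , j) = label m (parity (rank i)) (toℕ i) (rank i) j

  vertexLabel-injective : Injective _≡_ _≡_ vertexLabel
  vertexLabel-injective {i , j} {i′ , j′} eq
    -- Equal low bits give equal rank parities, so the halves can be compared under one common `p`.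
    with pī≡pī′ , half≡ ← bit+2*-injective (parity (rank i)) (parity (rank i′)) eq
    with i≡i′ , j≡j′ ← half-injective 2≤m (parity (rank i)) refl (sym pī≡pī′)
           (layer+rank i) (layer+rank i′) j j′
           (trans half≡ (cong (λ p → half m p (toℕ i′) (rank i′) j′) (sym pī≡pī′)))
    = cong₂ _,_ (toℕ-injective i≡i′) j≡j′

  vertexLabel-< : ∀ v → vertexLabel v < 2 * (2 * (m * 2))
  vertexLabel-< (i , j) = bit+2*-< (parity (rank i)) (half-< 2≤m (layer+rank i) j)

  edge : Fin 2 × Fin m × Fin 2 → G.V × G.V
  edge (c , t , δ) = (inject₁ t , proj₁ js) , (suc t , proj₂ js)
    where js = columns (parity (rank (suc t))) c δ

  -- The product is enumerated layer by layer, so moving up a layer raises the index whatever the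
  -- columns are.
  edge-ordered : ∀ e → G.index (proj₁ (edge e)) Fin.< G.index (proj₂ (edge e))
  edge-ordered (_ , t , _) = combine-monoˡ-< _ _ (≤-reflexive (cong suc (toℕ-inject₁ t)))

  edge-adjacent : ∀ e → G.Adj (proj₁ (edge e)) (proj₂ (edge e))
  edge-adjacent (c , t , δ) =
    inj₁ (cong suc (toℕ-inject₁ t)) , columns-adjacent (parity (rank (suc t))) c δ

  edge-upward : ∀ i i′ {j j′} → suc (toℕ i) ≡ toℕ i′ → Graph.Adj (P 3) j j′ →
                ∃[ e ] edge e ≡ ((i , j) , (i′ , j′))
  edge-upward i (suc t) 1+i≡1+t j~j′
    with refl ← toℕ-injective {i = i} (trans (suc-injective 1+i≡1+t) (sym (toℕ-inject₁ t)))
    with c , δ , refl ← columns-complete (parity (rank (suc t))) j~j′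
    = (c , t , δ) , refl

  edge-complete : ∀ {u v} → G.Adj u v → ∃[ e ] (edge e ≡ (u , v) ⊎ edge e ≡ (v , u))
  edge-complete {i , _} {i′ , _} (inj₁ up , j~j′) =
    map₂ inj₁ (edge-upward i i′ up j~j′)
  edge-complete {i , _} {i′ , _} (inj₂ down , j~j′) =
    map₂ inj₂ (edge-upward i′ i down (Graph.Adj-sym (P 3) j~j′))

  -- Chain first, then layer, then column: the order in which the edge labels increase.
  code : Fin 2 × Fin m × Fin 2 → Fin (2 * (m * 2))
  code (c , t , δ) = combine c (combine t δ)

  decode : Fin (2 * (m * 2)) → Fin 2 × Fin m × Fin 2
  decode k = map₂ (remQuot 2) (remQuot (m * 2) k)

  decode-code : ∀ e → decode (code e) ≡ e
  decode-code (c , t , δ) = trans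
    (cong (map₂ (remQuot 2)) (remQuot-combine c (combine t δ)))
    (cong (c ,_) (remQuot-combine t δ))

  code-decode : ∀ k → code (decode k) ≡ k
  code-decode k = trans
    (cong (combine c) (combine-remQuot {m} 2 x))
    (combine-remQuot {2} (m * 2) k)
    where
    c = proj₁ (remQuot {2} (m * 2) k)
    x = proj₂ (remQuot {2} (m * 2) k)

  edge-label : ∀ e →
    ∣ vertexLabel (proj₁ (edge e)) - vertexLabel (proj₂ (edge e)) ∣ ≡ 2 * toℕ (code e) + 1
  edge-label (c , t , δ) = begin
    ∣ vertexLabel (inject₁ t , j) - label m p (suc (toℕ t)) r j′ ∣
      ≡⟨ cong (λ x → ∣ x - label m p (suc (toℕ t)) r j′ ∣) lower ⟩
    ∣ label m (p ⁻¹) (toℕ t) (suc r) j - label m p (suc (toℕ t)) r j′ ∣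
      ≡⟨ gap⇒∣-∣ (label-gap r (toℕ t) (sym (m∸n+n≡m (toℕ<n t))) p c δ) ⟩
    2 * (m * 2 * toℕ c + (2 * toℕ t + toℕ δ)) + 1
      ≡⟨ cong (λ x → 2 * (m * 2 * toℕ c + x) + 1) (toℕ-combine t δ) ⟨
    2 * (m * 2 * toℕ c + toℕ (combine t δ)) + 1
      ≡⟨ cong (λ x → 2 * x + 1) (toℕ-combine c (combine t δ)) ⟨
    2 * toℕ (code (c , t , δ)) + 1 ∎
    where
    open ≡-Reasoning
    r = rank (suc t)
    p = parity r
    j = proj₁ (columns p c δ)
    j′ = proj₂ (columns p c δ)

    rank-inject₁ : rank (inject₁ t) ≡ suc r
    -- `(1 + m) ∸ suc (toℕ t)` reduces to `m ∸ toℕ t`, and `t < m` allows the 1 to be pulled out of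
    -- the truncated subtraction.
    rank-inject₁ = trans (cong (m ∸_) (toℕ-inject₁ t)) (+-∸-assoc 1 (toℕ<n t))

    lower : vertexLabel (inject₁ t , j) ≡ label m (p ⁻¹) (toℕ t) (suc r) j
    lower = trans
      (cong₂ (λ i ī → label m (parity ī) i ī j) (toℕ-inject₁ t) rank-inject₁)
      (cong (λ q → label m q (toℕ t) (suc r) j) (parity-suc r))

  P∧P₃-oddGraceful : OddGraceful (P (suc m) ∧ P 3)
  P∧P₃-oddGraceful = oddGraceful (P (suc m) ∧ P 3) (edge ∘ decode)
    (edge-ordered ∘ decode) (edge-adjacent ∘ decode)
    (decode-complete ∘ edge-complete)
    vertexLabel vertexLabel-injective vertexLabel-<
    (λ k → trans (edge-label (decode k)) (cong (λ x → 2 * toℕ x + 1) (code-decode k)))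
    where
    decode-complete : ∀ {u v} → ∃[ e ] (edge e ≡ (u , v) ⊎ edge e ≡ (v , u)) →
      ∃[ k ] (edge (decode k) ≡ (u , v) ⊎ edge (decode k) ≡ (v , u))
    decode-complete (e , eq) = code e ,
      subst (λ e → edge e ≡ _ ⊎ edge e ≡ _) (sym (decode-code e)) eq

theorem2 : (n : ℕ) → n > 2 → OddGraceful (P n ∧ P 3)
theorem2 (suc m) (s≤s 2≤m) = P∧P₃-oddGraceful 2≤m
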